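{- Let $T\in\mathbb{F}^{n}\otimes\mathbb{F}^{n}\otimes\mathbb{F}^{n}$ be a concise tensor that is pivot-matched. Then $\lim_{m\to\infty} Q(T^{\boxtimes m})^{1/m}\geq\sqrt{n}$.
   Context: $\mathbb{F}$ is any field. $T$ is concise if each of its three flattenings has rank $n$. The subrank $Q(T)$ is the largest $r$ with linear maps $L_i$ such that $(L_1\otimes L_2\otimes L_3)T=\sum_{i=1}^r e_i\otimes e_i\otimes e_i$; $\boxtimes$ is the Kronecker product, and $\lim_{m\to\infty} Q(T^{\boxtimes m})^{1/m}$ is the asymptotic subrank. The pivot $p(A)=(f(A),g(A))$ of a nonzero matrix $A$ is the lexicographically smallest index $(i,j)$ with $A_{i,j}\neq 0$; for matrices $A_1,\dots,A_n$ the pivot map is $\ell\mapsto p(A_\ell)$. $T$ is pivot-matched if there are tensors $T_A,T_B$ isomorphic (equivalent) to $T$ such that, with $A_i=\sum_{j,k}(T_A)_{i,j,k}e_j\otimes e_k$ ($i\in[n]$) the 1-slices of $T_A$ with pivot map $p_A=(f_A,g_A)$, and $B_k=\sum_{i,j}(T_B)_{i,j,k}e_i\otimes e_j$ ($k\in[n]$) the 3-slices of $T_B$ with pivot map $p_B=(f_B,g_B)$, both $p_A$ and $p_B$ are injective and $f_A(\ell)=f_B(\ell)$ for all $\ell\in[n]$. -}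

module Defs where

open import Level using (Level; _⊔_)
open import Algebra.Bundles using (CommutativeRing)
open import Data.Nat as ℕ using (ℕ; zero; suc)
open import Data.Fin as Fin using (Fin; zero; suc; quotient; remainder; _≟_)
import Data.Fin as F
open import Data.Product using (Σ; ∃; ∃-syntax; _×_; _,_; proj₁; proj₂)
open import Data.Sum using (_⊎_)
open import Relation.Nullary using (¬_; yes; no)
open import Relation.Binary.PropositionalEquality using (_≡_)
open import Function.Definitions using (Injective)

record Field (c ℓ : Level) : Set (Level.suc (c ⊔ ℓ)) where
  field
    commutativeRing : CommutativeRing c ℓ
  open CommutativeRing commutativeRing public
  field
    0≉1     : ¬ (0# ≈ 1#)
    inverse : ∀ x → ¬ (x ≈ 0#) → ∃[ y ] (x * y ≈ 1#)

module _ {c ℓ} (𝔽 : Field c ℓ) where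
  open Field 𝔽 using (Carrier; _≈_; _+_; _*_; 0#; 1#)

  ∑ : ∀ {n} → (Fin n → Carrier) → Carrier
  ∑ {zero}  f = 0#
  ∑ {suc n} f = f zero + ∑ (λ i → f (suc i))

  Tensor : ℕ → ℕ → ℕ → Set c
  Tensor a b d = Fin a → Fin b → Fin d → Carrier

  Mat : ℕ → ℕ → Set c
  Mat m n = Fin m → Fin n → Carrier

  apply : ∀ {a b d a' b' d'} → Mat a' a → Mat b' b → Mat d' d →
          Tensor a b d → Tensor a' b' d'
  apply L₁ L₂ L₃ T x y z =
    ∑ λ i → ∑ λ j → ∑ λ k → L₁ x i * (L₂ y j * (L₃ z k * T i j k))

  δ : ∀ {r} → Fin r → Fin r → Carrier
  δ i j with i ≟ j
  ... | yes _ = 1#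
  ... | no  _ = 0#

  unitTensor : ∀ r → Tensor r r r
  unitTensor r x y z = δ x y * δ y z

  SubrankAtLeast : ∀ {n} → Tensor n n n → ℕ → Set (c ⊔ ℓ)
  SubrankAtLeast {n} T r =
    Σ (Mat r n) λ L₁ → Σ (Mat r n) λ L₂ → Σ (Mat r n) λ L₃ →
      ∀ x y z → apply L₁ L₂ L₃ T x y z ≈ unitTensor r x y z

  -- Kronecker power T^{⊠m} ∈ F^{n^m} ⊗ F^{n^m} ⊗ F^{n^m};
  -- an index of F^{n^(m+1)} = F^n ⊗ F^{n^m} is split as (quotient, remainder).
  kronPow : ∀ {n} → Tensor n n n → (m : ℕ) →
            Tensor (n ℕ.^ m) (n ℕ.^ m) (n ℕ.^ m)
  kronPow T zero    x y z = 1#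
  kronPow {n} T (suc m) x y z =
    T (quotient (n ℕ.^ m) x) (quotient (n ℕ.^ m) y) (quotient (n ℕ.^ m) z)
    * kronPow T m (remainder {n} (n ℕ.^ m) x)
                  (remainder {n} (n ℕ.^ m) y)
                  (remainder {n} (n ℕ.^ m) z)

  FullRowRank : ∀ {m k} → Mat m k → Set (c ⊔ ℓ)
  FullRowRank {m} {k} M =
    (λc : Fin m → Carrier) → (∀ col → ∑ (λ i → λc i * M i col) ≈ 0#) →
    ∀ i → λc i ≈ 0#

  flat₁ flat₂ flat₃ : ∀ {n} → Tensor n n n → Mat n (n ℕ.* n)
  flat₁ {n} T i p = T i (quotient n p) (remainder {n} n p)
  flat₂ {n} T j p = T (quotient n p) j (remainder {n} n p)
  flat₃ {n} T k p = T (quotient n p) (remainder {n} n p) k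

  Concise : ∀ {n} → Tensor n n n → Set (c ⊔ ℓ)
  Concise T = FullRowRank (flat₁ T) × FullRowRank (flat₂ T) × FullRowRank (flat₃ T)

  _·_ : ∀ {n} → Mat n n → Mat n n → Mat n n
  (A · B) i j = ∑ λ k → A i k * B k j

  Id : ∀ {n} → Mat n n
  Id = δ

  Invertible : ∀ {n} → Mat n n → Set (c ⊔ ℓ)
  Invertible {n} A = Σ (Mat n n) λ B →
    (∀ i j → (A · B) i j ≈ Id i j) × (∀ i j → (B · A) i j ≈ Id i j)

  Isomorphic : ∀ {n} → Tensor n n n → Tensor n n n → Set (c ⊔ ℓ)
  Isomorphic {n} T' T =
    Σ (Mat n n) λ A → Σ (Mat n n) λ B → Σ (Mat n n) λ C →
      Invertible A × Invertible B × Invertible C ×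
      (∀ x y z → T' x y z ≈ apply A B C T x y z)

  LexLess : ∀ {n} → Fin n × Fin n → Fin n × Fin n → Set
  LexLess (i' , j') (i , j) = (i' F.< i) ⊎ ((i' ≡ i) × (j' F.< j))

  IsPivot : ∀ {n} → Mat n n → Fin n × Fin n → Set ℓ
  IsPivot A (i , j) =
    ¬ (A i j ≈ 0#) × (∀ i' j' → LexLess (i' , j') (i , j) → A i' j' ≈ 0#)

  slice₁ : ∀ {n} → Tensor n n n → Fin n → Mat n n
  slice₁ T i j k = T i j k

  slice₃ : ∀ {n} → Tensor n n n → Fin n → Mat n n
  slice₃ T k i j = T i j k

  PivotMatched : ∀ {n} → Tensor n n n → Set (c ⊔ ℓ)
  PivotMatched {n} T =
    Σ (Tensor n n n) λ TA → Σ (Tensor n n n) λ TB →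
    Σ (Fin n → Fin n × Fin n) λ pA → Σ (Fin n → Fin n × Fin n) λ pB →
      Isomorphic TA T × Isomorphic TB T ×
      (∀ ℓ → IsPivot (slice₁ TA ℓ) (pA ℓ)) ×
      (∀ ℓ → IsPivot (slice₃ TB ℓ) (pB ℓ)) ×
      Injective _≡_ _≡_ pA × Injective _≡_ _≡_ pB ×
      (∀ ℓ → proj₁ (pA ℓ) ≡ proj₁ (pB ℓ))

  -- lim_{m→∞} Q(T^{⊠m})^{1/m} ≥ √n, expressed with rationals a/b:
  -- for every a/b < √n (i.e. a² < n b²), eventually Q(T^{⊠m}) > (a/b)^m,
  -- i.e. Q(T^{⊠m}) ≥ r for some r with a^m < r · b^m.
  AsymptoticSubrankAtLeastSqrt : ∀ {n} → Tensor n n n → ℕ → Set (c ⊔ ℓ)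
  AsymptoticSubrankAtLeastSqrt T n =
    ∀ (a b : ℕ) → 0 ℕ.< b → a ℕ.* a ℕ.< n ℕ.* (b ℕ.* b) →
      ∃[ M ] ∀ m → M ℕ.≤ m →
        ∃[ r ] (SubrankAtLeast (kronPow T m) r × a ℕ.^ m ℕ.< r ℕ.* b ℕ.^ m)

{-# OPTIONS --safe #-}
-- Write p_A = (f, g) and p_B = (f, h) for the two pivot maps.  The tensor
-- S(a, b, c) = T_A(a, f b, g c) · T_B(f a, h b, c) is a subtensor of T_A ⊠ T_B.  With lexicographic
-- order encoded as the order of n f + g, a nonzero entry of S satisfies
-- n f b + g c ≥ n f a + g a and n f a + h b ≥ n f c + h c, hence g a + w c ≤ g c + w b where
-- w = n f + h; equality forces a = b = c by injectivity of the pivot maps, and the diagonal entries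
-- are products of pivots.  The same inequality holds for words, with g and w summed over letters.
-- Restricted to words of prescribed total g and prescribed total w, the power S^⊠k is therefore
-- diagonal, and the pigeonhole principle gives such a set of at least n^k / (k n² + 1)² words.  Thus
-- Q(T^⊠m) ≥ n^⌊m/2⌋ / poly(m).
module Submission where

open import Defs
open import Level using (Level; _⊔_)
import Data.Nat as ℕ
open import Data.Nat using (ℕ; zero; suc; _≤_; _<_; s≤s; z≤n; ⌊_/2⌋)
import Data.Nat.Properties as ℕ
open import Data.Nat.Tactic.RingSolver using (solve-∀)
open import Data.Fin using (Fin; zero; suc; toℕ; fromℕ<; quotient; remainder; combine; _↑ˡ_; _↑ʳ_; _≟_)
import Data.Fin.Properties as Fin
open import Data.List using (List; []; _∷_; length; filter; lookup; allFin)
open import Data.List.Properties using (length-tabulate)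
open import Data.List.Membership.Propositional.Properties using (∈-lookup)
open import Data.List.Relation.Unary.All as All using (All; []; _∷_)
import Data.List.Relation.Unary.All.Properties as All
open import Data.List.Relation.Unary.AllPairs using ([]; _∷_)
open import Data.List.Relation.Unary.Unique.Propositional using (Unique)
import Data.List.Relation.Unary.Unique.Propositional.Properties as Unique
open import Data.Product as Product using (Σ; ∃-syntax; _×_; _,_; proj₁; proj₂)
open import Data.Sum as Sum using (_⊎_; inj₁; inj₂)
open import Data.Empty using (⊥-elim)
open import Function using (_∘_; id)
open import Function.Definitions using (Injective)
open import Relation.Binary.PropositionalEquality as ≡ using (_≡_; cong; cong₂; subst)
open import Relation.Binary.Definitions using (tri<; tri≈; tri>)
open import Relation.Nullary using (¬_; yes; no)
open import Relation.Nullary.Decidable using (¬?)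
open import Relation.Unary using (Decidable)

-- Exponential growth against polynomial factors.

module Growth where
  open import Data.Nat using (_+_; _*_; _^_)
  open import Data.Nat.Properties
  open ≡ using (refl; sym; trans)

  -- The right side exceeds the left by t³ - q (3t² + 3t + 1). Substituting t = 1 + 7q + k turns
  -- this into a polynomial with nonnegative coefficients, which `identity` displays as the added
  -- summand.
  cubic-growth : ∀ q k → let t = suc (7 * q + k) in
    (1 + t) * (1 + t) * (1 + t) * q ≤ t * t * t * suc q
  cubic-growth q k = subst ((1 + t) * (1 + t) * (1 + t) * q ≤_) (sym (identity q k)) (m≤m+n _ _)
    where
    t = suc (7 * q + k)
    identity : ∀ q k → let u = 7 * q + k ; t = 1 + u in
      t * t * t * (1 + q) ≡
      (1 + t) * (1 + t) * (1 + t) * q + (t * t * (1 + k) + q * (4 * u * u + 5 * u))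
    identity = solve-∀

  -- The factor 7 absorbs 3t² + 3t + 1 ≤ 7t², so (1 + t)³ / t³ ≤ (1 + q) / q at each induction step.
  exponential-beats-cube : ∀ q k → let s = suc (7 * q) ; t = s + k in
    t * t * t * q ^ k < suc (s * s * s) * suc q ^ k
  exponential-beats-cube q zero = s≤s (≤-reflexive (cong (_* 1) (cong (λ t → t * t * t) (+-identityʳ (suc (7 * q))))))
  exponential-beats-cube q (suc k) = begin-strict
    (s + suc k) * (s + suc k) * (s + suc k) * (q * q ^ k)
      ≡⟨ cong (λ t → t * t * t * (q * q ^ k)) (+-suc s k) ⟩
    suc t * suc t * suc t * (q * q ^ k)
      ≡⟨ *-assoc (suc t * suc t * suc t) q (q ^ k) ⟨
    suc t * suc t * suc t * q * q ^ k
      ≤⟨ *-monoˡ-≤ (q ^ k) (cubic-growth q k) ⟩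
    t * t * t * suc q * q ^ k
      ≡⟨ rotate (t * t * t) (suc q) (q ^ k) ⟩
    suc q * (t * t * t * q ^ k)
      <⟨ *-monoʳ-< (suc q) (exponential-beats-cube q k) ⟩
    suc q * (suc (s * s * s) * suc q ^ k)
      ≡⟨ rotate₂ (suc q) (suc (s * s * s)) (suc q ^ k) ⟩
    suc (s * s * s) * (suc q * suc q ^ k) ∎
    where
    open ≤-Reasoning
    s = suc (7 * q)
    t = s + k
    rotate : ∀ x y z → x * y * z ≡ y * (x * z)
    rotate = solve-∀
    rotate₂ : ∀ x y z → x * (y * z) ≡ y * (x * z)
    rotate₂ = solve-∀

  -- The cubic estimate leaves one degree to spare. After 1 + kD ≤ k (1 + D), only k² and constants
  -- stand before `q ^ k`, and the threshold makes k large enough to absorb those constants, so that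
  -- k³ ≤ (s + k)³ finishes.
  exponential-beats-square : ∀ q c D →
    ∃[ M ] ∀ k → M ≤ k → c * (suc (k * D) * suc (k * D)) * q ^ k < suc q ^ k
  exponential-beats-square q c D = suc (C * c * (suc D * suc D)) , bound
    where
    s = suc (7 * q)
    C = suc (s * s * s)
    bound : ∀ k → suc (C * c * (suc D * suc D)) ≤ k →
            c * (suc (k * D) * suc (k * D)) * q ^ k < suc q ^ k
    -- The `suc` in the threshold rules out k = 0, where 1 + kD ≤ k (1 + D) fails.
    bound (suc k) M≤k = *-cancelˡ-< C _ _ (begin-strict
      C * (c * (suc (κ * D) * suc (κ * D)) * q ^ κ)
        ≤⟨ *-monoʳ-≤ C (*-monoˡ-≤ (q ^ κ) (*-monoʳ-≤ c (*-mono-≤ κD<κ[1+D] κD<κ[1+D]))) ⟩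
      C * (c * (κ * suc D * (κ * suc D)) * q ^ κ)
        ≡⟨ regroup C c κ (suc D) (q ^ κ) ⟩
      C * c * (suc D * suc D) * κ * κ * q ^ κ
        ≤⟨ *-monoˡ-≤ (q ^ κ) (*-monoˡ-≤ κ (*-monoˡ-≤ κ (<⇒≤ M≤k))) ⟩
      κ * κ * κ * q ^ κ
        ≤⟨ *-monoˡ-≤ (q ^ κ) (*-mono-≤ (*-mono-≤ κ≤s+κ κ≤s+κ) κ≤s+κ) ⟩
      (s + κ) * (s + κ) * (s + κ) * q ^ κ
        <⟨ exponential-beats-cube q κ ⟩
      C * suc q ^ κ ∎)
      where
      open ≤-Reasoning
      κ = suc k
      κ≤s+κ = m≤n+m κ s
      κD<κ[1+D] : suc (κ * D) ≤ κ * suc D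
      κD<κ[1+D] = ≤-trans (s≤s (m≤n+m (κ * D) k)) (≤-reflexive (sym (*-suc κ D)))
      regroup : ∀ C c κ d Q → C * (c * (κ * d * (κ * d)) * Q) ≡ C * c * (d * d) * κ * κ * Q
      regroup = solve-∀

  -- An odd m leaves one factor a over. The constant is `suc a` rather than `a` so that the bound
  -- survives a = 0, m = 0.
  ^-≤-⌊/2⌋ : ∀ a m → a ^ m ≤ suc a * (a * a) ^ ⌊ m /2⌋
  ^-≤-⌊/2⌋ a zero          = s≤s z≤n
  ^-≤-⌊/2⌋ a (suc zero)    = *-monoˡ-≤ 1 (n≤1+n a)
  ^-≤-⌊/2⌋ a (suc (suc m)) = begin
    a * (a * a ^ m)                       ≡⟨ *-assoc a a (a ^ m) ⟨
    a * a * a ^ m                         ≤⟨ *-monoʳ-≤ (a * a) (^-≤-⌊/2⌋ a m) ⟩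
    a * a * (suc a * (a * a) ^ ⌊ m /2⌋)   ≡⟨ exchange (a * a) (suc a) ((a * a) ^ ⌊ m /2⌋) ⟩
    suc a * (a * a * (a * a) ^ ⌊ m /2⌋)   ∎
    where
    open ≤-Reasoning
    exchange : ∀ x y z → x * (y * z) ≡ y * (x * z)
    exchange = solve-∀

  ⌊/2⌋-≤-^ : ∀ b m → 0 < b → (b * b) ^ ⌊ m /2⌋ ≤ b ^ m
  ⌊/2⌋-≤-^ b zero          0<b = ≤-refl
  ⌊/2⌋-≤-^ b (suc zero)    0<b = *-mono-≤ 0<b ≤-refl
  ⌊/2⌋-≤-^ b (suc (suc m)) 0<b =
    ≤-trans (*-monoʳ-≤ (b * b) (⌊/2⌋-≤-^ b m 0<b)) (≤-reflexive (*-assoc b b (b ^ m)))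

  ^-distribʳ-* : ∀ m n k → (m * n) ^ k ≡ m ^ k * n ^ k
  ^-distribʳ-* m n zero    = refl
  ^-distribʳ-* m n (suc k) = trans (cong (m * n *_) (^-distribʳ-* m n k)) (interchange m n (m ^ k) (n ^ k))
    where
    interchange : ∀ a b c d → a * b * (c * d) ≡ a * c * (b * d)
    interchange = solve-∀

  -- Over the integers a² < n b² means a² + 1 ≤ n b², and (a² + 1)^k outgrows (a²)^k times the
  -- factor (1 + a) B² lost to parity and pigeonhole. Both sides are multiplied by B², which is
  -- cancelled at the end, so no division occurs.
  growth-from-square : ∀ a b n D → 0 < b → a * a < n * (b * b) →
    ∃[ M ] ∀ m r → M ≤ m →
      let k = ⌊ m /2⌋ ; B = suc (k * D) in
      n ^ k ≤ r * (B * B) → a ^ m < r * b ^ m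
  -- Doubling the threshold ensures that ⌊m/2⌋ reaches it.
  growth-from-square a b n D 0<b a²<nb² = M + M , bound
    where
    q = a * a
    M = proj₁ (exponential-beats-square q (suc a) D)
    bound : ∀ m r → M + M ≤ m →
      let k = ⌊ m /2⌋ ; B = suc (k * D) in
      n ^ k ≤ r * (B * B) → a ^ m < r * b ^ m
    bound m r 2M≤m n^k≤ = *-cancelʳ-< (B * B) (a ^ m) (r * b ^ m) (begin-strict
      a ^ m * (B * B)
        ≤⟨ *-monoˡ-≤ (B * B) (^-≤-⌊/2⌋ a m) ⟩
      suc a * q ^ k * (B * B)
        ≡⟨ exchange (suc a) (q ^ k) (B * B) ⟩
      suc a * (B * B) * q ^ k
        <⟨ proj₂ (exponential-beats-square q (suc a) D) k M≤k ⟩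
      suc q ^ k
        ≤⟨ ^-monoˡ-≤ k a²<nb² ⟩
      (n * (b * b)) ^ k
        ≡⟨ ^-distribʳ-* n (b * b) k ⟩
      n ^ k * (b * b) ^ k
        ≤⟨ *-mono-≤ n^k≤ (⌊/2⌋-≤-^ b m 0<b) ⟩
      r * (B * B) * b ^ m
        ≡⟨ exchange r (B * B) (b ^ m) ⟩
      r * b ^ m * (B * B) ∎)
      where
      open ≤-Reasoning
      k = ⌊ m /2⌋
      B = suc (k * D)
      M≤k : M ≤ k
      M≤k = ≤-trans (≤-reflexive (n≡⌊n+n/2⌋ M)) (⌊n/2⌋-mono 2M≤m)
      exchange : ∀ x y z → x * y * z ≡ x * z * y
      exchange = solve-∀

-- The pigeonhole principle with large fibres.

module Pigeonhole where
  open import Data.Nat using (_+_; _*_)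
  open import Data.Nat.Properties hiding (_≟_)
  open ≡ using (refl; sym; trans)

  lookup-injective : ∀ {A : Set} {xs : List A} → Unique xs → Injective _≡_ _≡_ (lookup xs)
  lookup-injective (_ ∷ _)  {zero}  {zero}  _  = refl
  lookup-injective (x∉ ∷ _) {zero}  {suc j} eq = ⊥-elim (All.lookup x∉ (∈-lookup j) eq)
  lookup-injective (x∉ ∷ _) {suc i} {zero}  eq = ⊥-elim (All.lookup x∉ (∈-lookup i) (sym eq))
  lookup-injective (_ ∷ u)  {suc i} {suc j} eq = cong suc (lookup-injective u eq)

  length-filter-split : ∀ {A : Set} {P : A → Set} (P? : Decidable P) (xs : List A) →
    length xs ≡ length (filter P? xs) + length (filter (λ x → ¬? (P? x)) xs)
  length-filter-split P? [] = refl
  length-filter-split P? (x ∷ xs) with P? x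
  ... | yes _ = cong suc (length-filter-split P? xs)
  ... | no  _ = trans (cong suc (length-filter-split P? xs)) (sym (+-suc _ _))

  -- Induction on the number of keys: the elements with the top key are split off, and the longer of
  -- that class and the fibre found among the rest bounds both contributions.
  pigeonhole-list : ∀ {A : Set} (key : A → ℕ) K (xs : List A) →
    Unique xs → All (λ x → key x < K) xs →
    ∃[ v ] ∃[ ys ] Unique ys × All (λ y → key y ≡ v) ys × length xs ≤ length ys * K
  pigeonhole-list key zero    []       _ _ = 0 , [] , [] , [] , z≤n
  pigeonhole-list key zero    (x ∷ xs) _ (() ∷ _)
  pigeonhole-list {A} key (suc K) xs   u <1+K =
    choose (pigeonhole-list key K rest (Unique.filter⁺ _ u) rest<K)
    where
    top rest : List A
    top  = filter (λ x → key x ℕ.≟ K) xs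
    rest = filter (λ x → ¬? (key x ℕ.≟ K)) xs
    rest<K : All (λ x → key x < K) rest
    rest<K = All.map (λ (≢K , k<) → ≤∧≢⇒< (≤-pred k<) ≢K)
               (All.zip (All.all-filter _ xs , All.filter⁺ _ <1+K))
    bound : ∀ l → length top ≤ l → length rest ≤ l * K → length xs ≤ l * suc K
    bound l top≤ rest≤ = begin
      length xs                ≡⟨ length-filter-split (λ x → key x ℕ.≟ K) xs ⟩
      length top + length rest ≤⟨ +-mono-≤ top≤ rest≤ ⟩
      l + l * K                ≡⟨ *-suc l K ⟨
      l * suc K                ∎
      where open ≤-Reasoning
    choose :
      (∃[ v ] ∃[ ys ] Unique ys × All (λ y → key y ≡ v) ys × length rest ≤ length ys * K) →
      ∃[ v ] ∃[ ys ] Unique ys × All (λ y → key y ≡ v) ys × length xs ≤ length ys * suc K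
    choose (v , ys , uys , ≡v , rest≤) with ≤-total (length top) (length ys)
    ... | inj₁ top≤ys = v , ys , uys , ≡v , bound (length ys) top≤ys rest≤
    ... | inj₂ ys≤top =
      K , top , Unique.filter⁺ _ u , All.all-filter _ xs ,
      bound (length top) ≤-refl (≤-trans rest≤ (*-monoˡ-≤ K ys≤top))

  pigeonhole : ∀ {N K} (key : Fin N → Fin K) →
    ∃[ r ] Σ (Fin r → Fin N) λ e →
      Injective _≡_ _≡_ e × (∀ i j → key (e i) ≡ key (e j)) × N ≤ r * K
  pigeonhole {N} {K} key
    with pigeonhole-list (λ x → toℕ (key x)) K (allFin N) (Unique.allFin⁺ N) (All.universal (λ x → Fin.toℕ<n (key x)) _)
  ... | v , ys , u , ≡v , N≤ =
    length ys , lookup ys , lookup-injective u ,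
    (λ i j → Fin.toℕ-injective (trans (All.lookup ≡v (∈-lookup i)) (sym (All.lookup ≡v (∈-lookup j))))) ,
    ≤-trans (≤-reflexive (sym (length-tabulate (λ i → i)))) N≤

open Growth using (growth-from-square)
open Pigeonhole using (pigeonhole)

-- Nonnegative slacks with sum zero all vanish. This carries the equality case from single letters
-- to words, and from the sum of the two pivot inequalities back to each of them.
tight-sum : ∀ {m m' n n'} → m ≤ m' → n ≤ n' → m ℕ.+ n ≡ m' ℕ.+ n' → m ≡ m' × n ≡ n'
tight-sum {m} {m'} {n} {n'} m≤m' n≤n' eq =
  ℕ.≤-antisym m≤m' (ℕ.+-cancelʳ-≤ n' m' m (begin
    m' ℕ.+ n' ≡⟨ eq ⟨ m ℕ.+ n ≤⟨ ℕ.+-monoʳ-≤ m n≤n' ⟩ m ℕ.+ n' ∎)) ,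
  ℕ.≤-antisym n≤n' (ℕ.+-cancelˡ-≤ m' n' n (begin
    m' ℕ.+ n' ≡⟨ eq ⟨ m ℕ.+ n ≤⟨ ℕ.+-monoˡ-≤ n m≤m' ⟩ m' ℕ.+ n ∎))
  where open ℕ.≤-Reasoning

quotient-combine : ∀ {m n} (i : Fin m) (j : Fin n) → quotient n (combine i j) ≡ i
quotient-combine i j = cong proj₁ (Fin.remQuot-combine i j)

remainder-combine : ∀ {m n} (i : Fin m) (j : Fin n) → remainder {m} n (combine i j) ≡ j
remainder-combine i j = cong proj₂ (Fin.remQuot-combine i j)

-- Contractions, Kronecker products and restriction of tensors.

module Restriction {c ℓ : Level} (𝔽 : Field c ℓ) where
  open Field 𝔽 hiding (zero)
  open import Algebra.Properties.CommutativeSemigroup *-commutativeSemigroup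
    using () renaming (x∙yz≈y∙xz to x*yz≈y*xz)
  import Algebra.Properties.Semiring.Sum semiring as Sums
  open import Relation.Binary.Reasoning.Setoid setoid

  _∙_ : ∀ {n} → (Fin n → Carrier) → (Fin n → Carrier) → Carrier
  u ∙ F = ∑ 𝔽 (λ i → u i * F i)

  ∑-cong : ∀ {n} {F G : Fin n → Carrier} → (∀ i → F i ≈ G i) → ∑ 𝔽 F ≈ ∑ 𝔽 G
  ∑-cong {zero}  F≈G = refl
  ∑-cong {suc n} F≈G = +-cong (F≈G zero) (∑-cong (λ i → F≈G (suc i)))

  ∑-zero : ∀ {n} {F : Fin n → Carrier} → (∀ i → F i ≈ 0#) → ∑ 𝔽 F ≈ 0#
  ∑-zero {zero}  F≈0 = refl
  ∑-zero {suc n} F≈0 = trans (+-cong (F≈0 zero) (∑-zero (λ i → F≈0 (suc i)))) (+-identityˡ 0#)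

  -- A bridge to the library's sums, which carry the exchange and distributive laws.
  ∑≈sum : ∀ {n} (F : Fin n → Carrier) → ∑ 𝔽 F ≈ Sums.sum F
  ∑≈sum {zero}  F = refl
  ∑≈sum {suc n} F = +-congˡ (∑≈sum (λ i → F (suc i)))

  ∑-comm : ∀ {m n} (F : Fin m → Fin n → Carrier) →
    ∑ 𝔽 (λ i → ∑ 𝔽 (λ j → F i j)) ≈ ∑ 𝔽 (λ j → ∑ 𝔽 (λ i → F i j))
  ∑-comm {m} {n} F = begin
    ∑ 𝔽 (λ i → ∑ 𝔽 (λ j → F i j))               ≈⟨ ∑∑≈sum F ⟩
    Sums.sum (λ i → Sums.sum (λ j → F i j))     ≈⟨ Sums.∑-comm F ⟩
    Sums.sum (λ j → Sums.sum (λ i → F i j))     ≈⟨ ∑∑≈sum (λ j i → F i j) ⟨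
    ∑ 𝔽 (λ j → ∑ 𝔽 (λ i → F i j))               ∎
    where
    ∑∑≈sum : ∀ {m n} (G : Fin m → Fin n → Carrier) →
      ∑ 𝔽 (λ i → ∑ 𝔽 (λ j → G i j)) ≈ Sums.sum (λ i → Sums.sum (λ j → G i j))
    ∑∑≈sum G = trans (∑-cong (λ i → ∑≈sum (G i))) (∑≈sum (λ i → Sums.sum (G i)))

  *-distribˡ-∑ : ∀ {n} x (F : Fin n → Carrier) → x * ∑ 𝔽 F ≈ ∑ 𝔽 (λ i → x * F i)
  *-distribˡ-∑ x F = begin
    x * ∑ 𝔽 F                   ≈⟨ *-congˡ (∑≈sum F) ⟩
    x * Sums.sum F              ≈⟨ Sums.*-distribˡ-sum x F ⟩
    Sums.sum (λ i → x * F i)    ≈⟨ ∑≈sum (λ i → x * F i) ⟨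
    ∑ 𝔽 (λ i → x * F i)         ∎

  ∑-++ : ∀ m {n} (F : Fin (m ℕ.+ n) → Carrier) →
    ∑ 𝔽 F ≈ ∑ 𝔽 (λ i → F (i ↑ˡ n)) + ∑ 𝔽 (λ j → F (m ↑ʳ j))
  ∑-++ zero    F = sym (+-identityˡ _)
  ∑-++ (suc m) F = trans (+-congˡ (∑-++ m (λ i → F (suc i)))) (sym (+-assoc _ _ _))

  ∑-combine : ∀ {m n} (F : Fin (m ℕ.* n) → Carrier) →
    ∑ 𝔽 F ≈ ∑ 𝔽 (λ i → ∑ 𝔽 (λ j → F (combine {m} i j)))
  ∑-combine {zero}      F = refl
  ∑-combine {suc m} {n} F =
    trans (∑-++ n F) (+-congˡ (∑-combine {m} (λ i → F (n ↑ʳ i))))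

  δ-∙ : ∀ {n} (a : Fin n) (F : Fin n → Carrier) → δ 𝔽 a ∙ F ≈ F a
  δ-∙ {suc n} zero    F = trans (+-cong (*-identityˡ _) (∑-zero {F = λ i → 0# * F (suc i)} (λ _ → zeroˡ _))) (+-identityʳ _)
  δ-∙ {suc n} (suc a) F = begin
    0# * F zero + ∑ 𝔽 (λ i → δ 𝔽 (suc a) (suc i) * F (suc i)) ≈⟨ +-cong (zeroˡ _) (∑-cong (λ i → *-congʳ (δ-suc i))) ⟩
    0# + δ 𝔽 a ∙ (λ i → F (suc i))                            ≈⟨ +-identityˡ _ ⟩
    δ 𝔽 a ∙ (λ i → F (suc i))                                 ≈⟨ δ-∙ a (λ i → F (suc i)) ⟩
    F (suc a)                                                 ∎
    where
    δ-suc : ∀ i → δ 𝔽 (suc a) (suc i) ≈ δ 𝔽 a i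
    δ-suc i with a ≟ i
    ... | yes _ = refl
    ... | no  _ = refl

  ∙-congˡ : ∀ {n} (u : Fin n → Carrier) {F G : Fin n → Carrier} →
    (∀ i → F i ≈ G i) → u ∙ F ≈ u ∙ G
  ∙-congˡ u F≈G = ∑-cong (λ i → *-congˡ (F≈G i))

  *-∙ : ∀ {n} x (u F : Fin n → Carrier) → x * (u ∙ F) ≈ u ∙ (λ i → x * F i)
  *-∙ x u F = trans (*-distribˡ-∑ x (λ i → u i * F i)) (∑-cong (λ i → x*yz≈y*xz x (u i) (F i)))

  ∙-* : ∀ {n} (u F : Fin n → Carrier) x → u ∙ (λ i → F i * x) ≈ (u ∙ F) * x
  ∙-* u F x = trans (∙-congˡ u (λ i → *-comm (F i) x)) (trans (sym (*-∙ x u F)) (*-comm x _))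

  scale-∙ : ∀ {n} x (u F : Fin n → Carrier) → (λ i → x * u i) ∙ F ≈ x * (u ∙ F)
  scale-∙ x u F = trans (∑-cong (λ i → *-assoc x (u i) (F i))) (sym (*-distribˡ-∑ x (λ i → u i * F i)))

  ∙-comm : ∀ {m n} (u : Fin m → Carrier) (v : Fin n → Carrier) (F : Fin m → Fin n → Carrier) →
    u ∙ (λ i → v ∙ (λ j → F i j)) ≈ v ∙ (λ j → u ∙ (λ i → F i j))
  ∙-comm u v F = begin
    u ∙ (λ i → v ∙ (λ j → F i j))                       ≈⟨ ∑-cong (λ i → *-∙ (u i) v (F i)) ⟩
    ∑ 𝔽 (λ i → ∑ 𝔽 (λ j → v j * (u i * F i j)))         ≈⟨ ∑-comm (λ i j → v j * (u i * F i j)) ⟩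
    ∑ 𝔽 (λ j → ∑ 𝔽 (λ i → v j * (u i * F i j)))         ≈⟨ ∑-cong (λ j → sym (*-distribˡ-∑ (v j) (λ i → u i * F i j))) ⟩
    v ∙ (λ j → u ∙ (λ i → F i j))                       ∎

  ∙-assoc : ∀ {m n} (u : Fin m → Carrier) (M : Mat 𝔽 m n) (F : Fin n → Carrier) →
    (λ i → u ∙ (λ x → M x i)) ∙ F ≈ u ∙ (λ x → M x ∙ F)
  ∙-assoc u M F = begin
    (λ i → u ∙ (λ x → M x i)) ∙ F            ≈⟨ ∑-cong (λ i → sym (∙-* u (λ x → M x i) (F i))) ⟩
    ∑ 𝔽 (λ i → u ∙ (λ x → M x i * F i))      ≈⟨ ∑-comm (λ i x → u x * (M x i * F i)) ⟩
    ∑ 𝔽 (λ x → ∑ 𝔽 (λ i → u x * (M x i * F i))) ≈⟨ ∑-cong (λ x → sym (*-distribˡ-∑ (u x) (λ i → M x i * F i))) ⟩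
    u ∙ (λ x → M x ∙ F)                      ∎

  _⊗_ : ∀ {m n} → (Fin m → Carrier) → (Fin n → Carrier) → Fin (m ℕ.* n) → Carrier
  _⊗_ {m} {n} u v p = u (quotient n p) * v (remainder {m} n p)

  ⊗-∙ : ∀ {m n} (u : Fin m → Carrier) (v : Fin n → Carrier) (F : Fin (m ℕ.* n) → Carrier) →
    (u ⊗ v) ∙ F ≈ u ∙ (λ i → v ∙ (λ j → F (combine i j)))
  ⊗-∙ {m} {n} u v F = begin
    (u ⊗ v) ∙ F
      ≈⟨ ∑-combine {m} {n} _ ⟩
    ∑ 𝔽 (λ i → ∑ 𝔽 (λ j → (u ⊗ v) (combine {m} i j) * F (combine i j)))
      ≈⟨ ∑-cong (λ i → ∑-cong (λ j → *-congʳ (reflexive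
           (≡.cong₂ (λ a b → u a * v b) (quotient-combine i j) (remainder-combine i j))))) ⟩
    ∑ 𝔽 (λ i → ∑ 𝔽 (λ j → u i * v j * F (combine i j)))
      ≈⟨ ∑-cong (λ i → trans (∑-cong (λ j → *-assoc (u i) (v j) _)) (sym (*-distribˡ-∑ (u i) (λ j → v j * F (combine i j))))) ⟩
    u ∙ (λ i → v ∙ (λ j → F (combine i j))) ∎

  -- The coefficients that `apply` keeps under all three sums are pulled out, leaving nested
  -- pairings. Composition and Kronecker products then follow from the laws of `_∙_` alone.
  trilinear : ∀ {a b d} → Tensor 𝔽 a b d →
    (Fin a → Carrier) → (Fin b → Carrier) → (Fin d → Carrier) → Carrier
  trilinear T u v w = u ∙ (λ i → v ∙ (λ j → w ∙ (λ k → T i j k)))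

  trilinear-cong : ∀ {a b d} {S T : Tensor 𝔽 a b d} → (∀ i j k → S i j k ≈ T i j k) →
    ∀ u v w → trilinear S u v w ≈ trilinear T u v w
  trilinear-cong S≈T u v w =
    ∙-congˡ u (λ i → ∙-congˡ v (λ j → ∙-congˡ w (λ k → S≈T i j k)))

  apply≈trilinear : ∀ {a b d a' b' d'} (L₁ : Mat 𝔽 a' a) (L₂ : Mat 𝔽 b' b) (L₃ : Mat 𝔽 d' d)
    (T : Tensor 𝔽 a b d) x y z →
    apply 𝔽 L₁ L₂ L₃ T x y z ≈ trilinear T (L₁ x) (L₂ y) (L₃ z)
  apply≈trilinear L₁ L₂ L₃ T x y z = ∑-cong (λ i → begin
    ∑ 𝔽 (λ j → ∑ 𝔽 (λ k → L₁ x i * (L₂ y j * (L₃ z k * T i j k))))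
      ≈⟨ ∑-cong (λ j → sym (*-distribˡ-∑ (L₁ x i) (λ k → L₂ y j * (L₃ z k * T i j k)))) ⟩
    ∑ 𝔽 (λ j → L₁ x i * ∑ 𝔽 (λ k → L₂ y j * (L₃ z k * T i j k)))
      ≈⟨ sym (*-distribˡ-∑ (L₁ x i) (λ j → ∑ 𝔽 (λ k → L₂ y j * (L₃ z k * T i j k)))) ⟩
    L₁ x i * ∑ 𝔽 (λ j → ∑ 𝔽 (λ k → L₂ y j * (L₃ z k * T i j k)))
      ≈⟨ *-congˡ (∑-cong (λ j → sym (*-distribˡ-∑ (L₂ y j) (λ k → L₃ z k * T i j k)))) ⟩
    L₁ x i * (L₂ y ∙ (λ j → L₃ z ∙ (λ k → T i j k))) ∎)

  -- Composition of linear maps on the three legs. Each `∙-assoc` exposes an outer sum, and each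
  -- `∙-comm` moves it in front of a contraction with `T`.
  trilinear-apply : ∀ {a b d a' b' d'} (M₁ : Mat 𝔽 a' a) (M₂ : Mat 𝔽 b' b) (M₃ : Mat 𝔽 d' d)
    (T : Tensor 𝔽 a b d) u v w →
    trilinear T (λ i → u ∙ (λ x → M₁ x i)) (λ j → v ∙ (λ y → M₂ y j)) (λ k → w ∙ (λ z → M₃ z k))
    ≈ trilinear (λ x y z → trilinear T (M₁ x) (M₂ y) (M₃ z)) u v w
  trilinear-apply M₁ M₂ M₃ T u v w = begin
    trilinear T _ _ _
      ≈⟨ ∙-assoc u M₁ _ ⟩
    u ∙ (λ x → M₁ x ∙ (λ i → vM ∙ (λ j → wM ∙ (λ k → T i j k))))
      ≈⟨ ∙-congˡ u (λ x → ∙-congˡ (M₁ x) (λ i → ∙-assoc v M₂ _)) ⟩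
    u ∙ (λ x → M₁ x ∙ (λ i → v ∙ (λ y → M₂ y ∙ (λ j → wM ∙ (λ k → T i j k)))))
      ≈⟨ ∙-congˡ u (λ x → ∙-comm (M₁ x) v _) ⟩
    u ∙ (λ x → v ∙ (λ y → M₁ x ∙ (λ i → M₂ y ∙ (λ j → wM ∙ (λ k → T i j k)))))
      ≈⟨ ∙-congˡ u (λ x → ∙-congˡ v (λ y → ∙-congˡ (M₁ x) (λ i → ∙-congˡ (M₂ y) (λ j → ∙-assoc w M₃ _)))) ⟩
    u ∙ (λ x → v ∙ (λ y → M₁ x ∙ (λ i → M₂ y ∙ (λ j → w ∙ (λ z → M₃ z ∙ (λ k → T i j k))))))
      ≈⟨ ∙-congˡ u (λ x → ∙-congˡ v (λ y → ∙-congˡ (M₁ x) (λ i → ∙-comm (M₂ y) w _))) ⟩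
    u ∙ (λ x → v ∙ (λ y → M₁ x ∙ (λ i → w ∙ (λ z → M₂ y ∙ (λ j → M₃ z ∙ (λ k → T i j k))))))
      ≈⟨ ∙-congˡ u (λ x → ∙-congˡ v (λ y → ∙-comm (M₁ x) w _)) ⟩
    trilinear (λ x y z → trilinear T (M₁ x) (M₂ y) (M₃ z)) u v w ∎
    where
    vM = λ j → v ∙ (λ y → M₂ y j)
    wM = λ k → w ∙ (λ z → M₃ z k)

  -- The index splitting copies that of `kronPow`, so that `kronPow 𝔽 T (suc m)` unfolds to
  -- `T ⊠ kronPow 𝔽 T m`.
  _⊠_ : ∀ {a b d a' b' d'} → Tensor 𝔽 a b d → Tensor 𝔽 a' b' d' →
    Tensor 𝔽 (a ℕ.* a') (b ℕ.* b') (d ℕ.* d')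
  _⊠_ {a} {b} {d} {a'} {b'} {d'} S T x y z =
    S (quotient a' x) (quotient b' y) (quotient d' z)
    * T (remainder {a} a' x) (remainder {b} b' y) (remainder {d} d' z)

  ⊠-combine : ∀ {a b d a' b' d'} (S : Tensor 𝔽 a b d) (T : Tensor 𝔽 a' b' d')
    i i' j j' k k' →
    (S ⊠ T) (combine i i') (combine j j') (combine k k') ≡ S i j k * T i' j' k'
  ⊠-combine S T i i' j j' k k'
    rewrite quotient-combine i i' | quotient-combine j j' | quotient-combine k k'
          | remainder-combine i i' | remainder-combine j j' | remainder-combine k k' = ≡.refl

  -- For product vectors, the sum on each leg becomes a double sum, and these double sums factor
  -- from the innermost leg outwards.
  trilinear-⊠ : ∀ {a b d a' b' d'} (S : Tensor 𝔽 a b d) (T : Tensor 𝔽 a' b' d') u u' v v' w w' →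
    trilinear (S ⊠ T) (u ⊗ u') (v ⊗ v') (w ⊗ w') ≈ trilinear S u v w * trilinear T u' v' w'
  trilinear-⊠ S T u u' v v' w w' = begin
    trilinear (S ⊠ T) (u ⊗ u') (v ⊗ v') (w ⊗ w')
      ≈⟨ ⊗-∙ u u' _ ⟩
    u ∙ (λ i → u' ∙ (λ i' → (v ⊗ v') ∙ (λ y → (w ⊗ w') ∙ (λ z → (S ⊠ T) (combine i i') y z))))
      ≈⟨ ∙-congˡ u (λ i → ∙-congˡ u' (λ i' → ⊗-∙ v v' _)) ⟩
    u ∙ (λ i → u' ∙ (λ i' → v ∙ (λ j → v' ∙ (λ j' → (w ⊗ w') ∙ (λ z → (S ⊠ T) (combine i i') (combine j j') z)))))
      ≈⟨ ∙-congˡ u (λ i → ∙-congˡ u' (λ i' → ∙-congˡ v (λ j → ∙-congˡ v' (λ j' → begin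
           (w ⊗ w') ∙ (λ z → (S ⊠ T) (combine i i') (combine j j') z)
             ≈⟨ ⊗-∙ w w' _ ⟩
           w ∙ (λ k → w' ∙ (λ k' → (S ⊠ T) (combine i i') (combine j j') (combine k k')))
             ≈⟨ ∙-congˡ w (λ k → ∙-congˡ w' (λ k' → reflexive (⊠-combine S T i i' j j' k k'))) ⟩
           w ∙ (λ k → w' ∙ (λ k' → S i j k * T i' j' k'))
             ≈⟨ product w w' (S i j) (T i' j') ⟩
           (w ∙ S i j) * (w' ∙ T i' j') ∎)))) ⟩
    u ∙ (λ i → u' ∙ (λ i' → v ∙ (λ j → v' ∙ (λ j' → (w ∙ S i j) * (w' ∙ T i' j')))))
      ≈⟨ ∙-congˡ u (λ i → ∙-congˡ u' (λ i' → product v v' _ _)) ⟩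
    u ∙ (λ i → u' ∙ (λ i' → (v ∙ (λ j → w ∙ S i j)) * (v' ∙ (λ j' → w' ∙ T i' j'))))
      ≈⟨ product u u' _ _ ⟩
    trilinear S u v w * trilinear T u' v' w' ∎
    where
    product : ∀ {m n} (u : Fin m → Carrier) (v : Fin n → Carrier) F G →
      u ∙ (λ i → v ∙ (λ j → F i * G j)) ≈ (u ∙ F) * (v ∙ G)
    product u v F G = trans (∙-congˡ u (λ i → sym (*-∙ (F i) v G))) (∙-* u F (v ∙ G))

  infix 4 _≼_

  -- The restriction preorder between tensors of possibly different formats; the subrank is at least
  -- r exactly when `unitTensor 𝔽 r ≼ T`.
  record _≼_ {a b d a' b' d'} (S : Tensor 𝔽 a' b' d') (T : Tensor 𝔽 a b d) : Set (c ⊔ ℓ) where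
    constructor restrict
    field
      L₁ : Mat 𝔽 a' a
      L₂ : Mat 𝔽 b' b
      L₃ : Mat 𝔽 d' d
      trilinear≈ : ∀ x y z → trilinear T (L₁ x) (L₂ y) (L₃ z) ≈ S x y z

  ≼-trans : ∀ {a b d a' b' d' a″ b″ d″}
    {R : Tensor 𝔽 a″ b″ d″} {S : Tensor 𝔽 a' b' d'} {T : Tensor 𝔽 a b d} →
    R ≼ S → S ≼ T → R ≼ T
  ≼-trans {T = T} (restrict L₁ L₂ L₃ R≈) (restrict M₁ M₂ M₃ S≈) = restrict _ _ _ λ x y z →
    trans (trilinear-apply M₁ M₂ M₃ T (L₁ x) (L₂ y) (L₃ z))
      (trans (trilinear-cong S≈ (L₁ x) (L₂ y) (L₃ z)) (R≈ x y z))

  ⊠-mono-≼ : ∀ {a b d a' b' d' e f g e' f' g'}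
    {S : Tensor 𝔽 a' b' d'} {T : Tensor 𝔽 a b d}
    {S' : Tensor 𝔽 e' f' g'} {T' : Tensor 𝔽 e f g} →
    S ≼ T → S' ≼ T' → (S ⊠ S') ≼ (T ⊠ T')
  ⊠-mono-≼ {a' = a'} {b'} {d'} {e' = e'} {f'} {g'} {T = T} {T' = T'}
    (restrict L₁ L₂ L₃ S≈) (restrict M₁ M₂ M₃ S'≈) =
    restrict
      (λ x → L₁ (quotient e' x) ⊗ M₁ (remainder {a'} e' x))
      (λ y → L₂ (quotient f' y) ⊗ M₂ (remainder {b'} f' y))
      (λ z → L₃ (quotient g' z) ⊗ M₃ (remainder {d'} g' z))
      λ x y z → trans (trilinear-⊠ T T' _ _ _ _ _ _) (*-cong (S≈ _ _ _) (S'≈ _ _ _))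

  -- The rows of the matrices are unit vectors, scaled on the first leg. Scaling one leg is enough
  -- to normalise a diagonal tensor or a single entry.
  rescaledSubtensor-≼ : ∀ {a b d a' b' d'} {S : Tensor 𝔽 a' b' d'} {T : Tensor 𝔽 a b d}
    (s : Fin a' → Carrier) (f : Fin a' → Fin a) (g : Fin b' → Fin b) (h : Fin d' → Fin d) →
    (∀ x y z → s x * T (f x) (g y) (h z) ≈ S x y z) → S ≼ T
  rescaledSubtensor-≼ {T = T} s f g h eq =
    restrict (λ x i → s x * δ 𝔽 (f x) i) (λ y → δ 𝔽 (g y)) (λ z → δ 𝔽 (h z)) λ x y z →
      trans (scale-∙ (s x) (δ 𝔽 (f x)) _)
        (trans (*-congˡ (trans (δ-∙ (f x) _) (trans (δ-∙ (g y) _) (δ-∙ (h z) _))))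
          (eq x y z))

  subtensor-≼ : ∀ {a b d a' b' d'} {S : Tensor 𝔽 a' b' d'} {T : Tensor 𝔽 a b d}
    (f : Fin a' → Fin a) (g : Fin b' → Fin b) (h : Fin d' → Fin d) →
    (∀ x y z → T (f x) (g y) (h z) ≈ S x y z) → S ≼ T
  subtensor-≼ f g h eq =
    rescaledSubtensor-≼ (λ _ → 1#) f g h λ x y z → trans (*-identityˡ _) (eq x y z)

  ≼-refl : ∀ {a b d} {T : Tensor 𝔽 a b d} → T ≼ T
  ≼-refl = subtensor-≼ id id id (λ _ _ _ → refl)

  Isomorphic⇒≼ : ∀ {n} (S T : Tensor 𝔽 n n n) → Isomorphic 𝔽 S T → S ≼ T
  Isomorphic⇒≼ S T (A , B , C , _ , _ , _ , S≈) = restrict A B C λ x y z →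
    trans (sym (apply≈trilinear A B C T x y z)) (sym (S≈ x y z))

  *-nonZero : ∀ {x y} → ¬ (x ≈ 0#) → ¬ (y ≈ 0#) → ¬ (x * y ≈ 0#)
  *-nonZero {x} {y} x≉0 y≉0 xy≈0 with inverse x x≉0
  ... | x⁻¹ , xx⁻¹≈1 = y≉0 (begin
    y               ≈⟨ *-identityˡ y ⟨
    1# * y          ≈⟨ *-congʳ xx⁻¹≈1 ⟨
    x * x⁻¹ * y     ≈⟨ *-congʳ (*-comm x x⁻¹) ⟩
    x⁻¹ * x * y     ≈⟨ *-assoc x⁻¹ x y ⟩
    x⁻¹ * (x * y)   ≈⟨ *-congˡ xy≈0 ⟩
    x⁻¹ * 0#        ≈⟨ zeroʳ x⁻¹ ⟩
    0#              ∎)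

-- Additive weights on words, and large fibres of two weights.

wordWeight : ∀ {n} → (Fin n → ℕ) → ∀ k → Fin (n ℕ.^ k) → ℕ
wordWeight     w zero    x = 0
wordWeight {n} w (suc k) x =
  w (quotient (n ℕ.^ k) x) ℕ.+ wordWeight w k (remainder {n} (n ℕ.^ k) x)

wordWeight-≤ : ∀ {n D} (w : Fin n → ℕ) → (∀ x → w x ≤ D) → ∀ k x → wordWeight w k x ≤ k ℕ.* D
wordWeight-≤ w w≤D zero    x = z≤n
wordWeight-≤ w w≤D (suc k) x = ℕ.+-mono-≤ (w≤D _) (wordWeight-≤ w w≤D k _)

quotient-remainder-injective : ∀ {m} n {x y : Fin (m ℕ.* n)} →
  quotient {m} n x ≡ quotient n y → remainder {m} n x ≡ remainder {m} n y → x ≡ y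
quotient-remainder-injective {m} n {x} {y} q r = begin
  x                                               ≡⟨ Fin.combine-remQuot {m} n x ⟨
  combine (quotient {m} n x) (remainder {m} n x)  ≡⟨ cong₂ combine q r ⟩
  combine (quotient {m} n y) (remainder {m} n y)  ≡⟨ Fin.combine-remQuot {m} n y ⟩
  y                                               ∎
  where open ≡.≡-Reasoning

-- The pair of weights is a single key with K² possible values, whence the loss of K². The fibre
-- comes with an injective enumeration that later serves as index map on all three legs.
fibre-of-two-weights : ∀ {N K} (v w : Fin N → ℕ) → (∀ x → v x < K) → (∀ x → w x < K) →
  ∃[ r ] Σ (Fin r → Fin N) λ e →
    Injective _≡_ _≡_ e × (∀ i j → v (e i) ≡ v (e j)) × (∀ i j → w (e i) ≡ w (e j)) ×
    N ≤ r ℕ.* (K ℕ.* K)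
fibre-of-two-weights {N} {K} v w v<K w<K =
  let (r , e , e-injective , same , N≤) = pigeonhole key
  in r , e , e-injective ,
     (λ i j → Fin.fromℕ<-injective _ _ (v<K _) (v<K _)
                (Fin.combine-injectiveˡ _ (w′ (e i)) _ (w′ (e j)) (same i j))) ,
     (λ i j → Fin.fromℕ<-injective _ _ (w<K _) (w<K _)
                (Fin.combine-injectiveʳ (v′ (e i)) _ (v′ (e j)) _ (same i j))) ,
     N≤
  where
  v′ w′ : Fin N → Fin K
  v′ x = fromℕ< (v<K x)
  w′ x = fromℕ< (w<K x)
  key : Fin N → Fin (K ℕ.* K)
  key x = combine (v′ x) (w′ x)

-- Diagonal tensors from weights.

module Subrank {c ℓ : Level} (𝔽 : Field c ℓ) where
  open Field 𝔽 hiding (zero)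
  open Restriction 𝔽
  open import Relation.Binary.Reasoning.Setoid setoid

  -- Rescaling the first leg by the inverses of the diagonal entries normalises the diagonal; off it
  -- both sides vanish.
  unitTensor-≼ : ∀ {n} (S : Tensor 𝔽 n n n) →
    (∀ x y z → S x y z ≈ 0# ⊎ (x ≡ y × y ≡ z)) → (∀ x → ¬ (S x x x ≈ 0#)) →
    unitTensor 𝔽 n ≼ S
  unitTensor-≼ S offDiagonal diagonal =
    rescaledSubtensor-≼ (λ x → proj₁ (inverse (S x x x) (diagonal x))) id id id entry
    where
    entry : ∀ x y z → proj₁ (inverse (S x x x) (diagonal x)) * S x y z ≈ δ 𝔽 x y * δ 𝔽 y z
    entry x y z with x ≟ y | y ≟ z
    ... | yes ≡.refl | yes ≡.refl =
      trans (*-comm _ _) (trans (proj₂ (inverse (S x x x) (diagonal x))) (sym (*-identityˡ 1#)))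
    ... | yes _  | no y≢z with offDiagonal x y z
    ...   | inj₁ S≈0       = trans (trans (*-congˡ S≈0) (zeroʳ _)) (sym (zeroʳ 1#))
    ...   | inj₂ (_ , y≡z) = ⊥-elim (y≢z y≡z)
    entry x y z | no x≢y | q with offDiagonal x y z
    ...   | inj₁ S≈0       = trans (trans (*-congˡ S≈0) (zeroʳ _)) (sym (zeroˡ _))
    ...   | inj₂ (x≡y , _) = ⊥-elim (x≢y x≡y)

  -- The inequality says (v x - v z) + (w z - w y) ≤ 0, written without subtraction. It is additive,
  -- hence stable under Kronecker powers, and on indices where `v` and `w` are both constant it is
  -- an equality, which leaves only the diagonal. The disjunction is used because equality in the
  -- field need not be decidable.
  record WeightedDiagonal {n} (S : Tensor 𝔽 n n n) (v w : Fin n → ℕ) : Set ℓ where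
    field
      support : ∀ x y z → S x y z ≈ 0# ⊎
        (v x ℕ.+ w z ≤ v z ℕ.+ w y × (v x ℕ.+ w z ≡ v z ℕ.+ w y → x ≡ y × y ≡ z))
      diagonal : ∀ x → ¬ (S x x x ≈ 0#)
  open WeightedDiagonal

  -- If either factor of an entry vanishes, so does the entry. Otherwise the inequalities add up,
  -- and equality of the sums forces equality for the first letter and for the remaining word.
  kronPow-weightedDiagonal : ∀ {n} {S : Tensor 𝔽 n n n} {v w} → WeightedDiagonal S v w →
    ∀ k → WeightedDiagonal (kronPow 𝔽 S k) (wordWeight v k) (wordWeight w k)
  kronPow-weightedDiagonal _ zero = record
    { support  = λ { zero zero zero → inj₂ (z≤n , λ _ → ≡.refl , ≡.refl) }
    ; diagonal = λ _ 1≈0 → 0≉1 (sym 1≈0)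
    }
  kronPow-weightedDiagonal {n} {S} {v} {w} wd (suc k) = record
    { support = support′ ; diagonal = λ x → *-nonZero (diagonal wd _) (diagonal ih _) }
    where
    N = n ℕ.^ k
    ih = kronPow-weightedDiagonal wd k
    interchange : ∀ a b c d → (a ℕ.+ b) ℕ.+ (c ℕ.+ d) ≡ (a ℕ.+ c) ℕ.+ (b ℕ.+ d)
    interchange = solve-∀
    V = wordWeight v k
    W = wordWeight w k
    support′ : ∀ x y z → kronPow 𝔽 S (suc k) x y z ≈ 0# ⊎
      (wordWeight v (suc k) x ℕ.+ wordWeight w (suc k) z ≤ wordWeight v (suc k) z ℕ.+ wordWeight w (suc k) y ×
       (wordWeight v (suc k) x ℕ.+ wordWeight w (suc k) z ≡ wordWeight v (suc k) z ℕ.+ wordWeight w (suc k) y →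
        x ≡ y × y ≡ z))
    support′ x y z
      with support wd (quotient N x) (quotient N y) (quotient N z)
         | support ih (remainder {n} N x) (remainder {n} N y) (remainder {n} N z)
    ... | inj₁ ≈0 | _ = inj₁ (trans (*-congʳ ≈0) (zeroˡ _))
    ... | inj₂ _  | inj₁ ≈0 = inj₁ (trans (*-congˡ ≈0) (zeroʳ _))
    ... | inj₂ (≤₁ , tight₁) | inj₂ (≤₂ , tight₂) = inj₂
      ( ≡.subst₂ _≤_ (≡.sym left) (≡.sym right) (ℕ.+-mono-≤ ≤₁ ≤₂)
      , λ eq → let (eq₁ , eq₂)   = tight-sum ≤₁ ≤₂ (≡.trans (≡.sym left) (≡.trans eq right))
                   (xy₁ , yz₁) = tight₁ eq₁
                   (xy₂ , yz₂) = tight₂ eq₂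
               in quotient-remainder-injective {n} N xy₁ xy₂ ,
                  quotient-remainder-injective {n} N yz₁ yz₂ )
      where
      left  = interchange (v (quotient N x)) (V (remainder {n} N x)) (w (quotient N z)) (W (remainder {n} N z))
      right = interchange (v (quotient N z)) (V (remainder {n} N z)) (w (quotient N y)) (W (remainder {n} N y))

  -- Along a common fibre of both weights every triple is in the equality case, so the restricted
  -- power is diagonal; injectivity of `e` turns equal words into equal indices.
  kronPow-subrank : ∀ {n K} {S : Tensor 𝔽 n n n} {v w} → WeightedDiagonal S v w →
    ∀ k → (∀ x → wordWeight v k x < K) → (∀ x → wordWeight w k x < K) →
    ∃[ r ] (unitTensor 𝔽 r ≼ kronPow 𝔽 S k × n ℕ.^ k ≤ r ℕ.* (K ℕ.* K))
  kronPow-subrank {n} {S = S} {v} {w} wd k v<K w<K =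
    let wd^k = kronPow-weightedDiagonal wd k
        (r , e , e-injective , sameV , sameW , n^k≤) =
          fibre-of-two-weights (wordWeight v k) (wordWeight w k) v<K w<K
    in r ,
       ≼-trans
         (unitTensor-≼ (λ x y z → kronPow 𝔽 S k (e x) (e y) (e z))
           (λ x y z → Sum.map₂
             (λ (_ , tight) → Product.map e-injective e-injective
               (tight (cong₂ ℕ._+_ (sameV x z) (sameW z y))))
             (support wd^k (e x) (e y) (e z)))
           (λ x → diagonal wd^k (e x)))
         (subtensor-≼ e e e (λ _ _ _ → refl)) ,
       n^k≤

  -- The case split compares positions, never entries, so no test for zero in the field is needed.
  -- Coding positions as numbers lets two pivot conditions be added.
  pivot-≤ : ∀ {n} {A : Mat 𝔽 n n} {i j} → IsPivot 𝔽 A (i , j) → ∀ i' j' →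
    A i' j' ≈ 0# ⊎ toℕ (combine i j) ≤ toℕ (combine i' j')
  pivot-≤ {i = i} {j} (_ , before) i' j' with Fin.<-cmp i' i
  ... | tri< i'<i _ _ = inj₁ (before i' j' (inj₁ i'<i))
  ... | tri> _ _ i<i' = inj₂ (ℕ.<⇒≤ (Fin.combine-monoˡ-< j j' i<i'))
  ... | tri≈ _ ≡.refl _ with j' Fin.<? j
  ...   | yes j'<j = inj₁ (before i' j' (inj₂ (≡.refl , j'<j)))
  ...   | no  j'≮j = inj₂ (≡.subst₂ _≤_ (≡.sym (Fin.toℕ-combine i j)) (≡.sym (Fin.toℕ-combine i j'))
                            (ℕ.+-monoʳ-≤ _ (ℕ.≮⇒≥ j'≮j)))

  -- The pivot tensor and its powers.

  module _ {n : ℕ} (TA TB : Tensor 𝔽 n n n) (F G H : Fin n → Fin n)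
    (pivotA : ∀ ℓ → IsPivot 𝔽 (slice₁ 𝔽 TA ℓ) (F ℓ , G ℓ))
    (pivotB : ∀ ℓ → IsPivot 𝔽 (slice₃ 𝔽 TB ℓ) (F ℓ , H ℓ))
    (injectiveA : Injective _≡_ _≡_ (λ ℓ → F ℓ , G ℓ))
    (injectiveB : Injective _≡_ _≡_ (λ ℓ → F ℓ , H ℓ)) where

    -- The subtensor of TA ⊠ TB on the indices (a, F a), (F b, H b), (G c, c).
    pivotTensor : Tensor 𝔽 n n n
    pivotTensor a b c = TA a (F b) (G c) * TB (F a) (H b) c

    private
      v w : Fin n → ℕ
      v ℓ = toℕ (G ℓ)
      w ℓ = toℕ (combine (F ℓ) (H ℓ))

    -- The pivot conditions read (F a , G a) ≤ (F b , G c) and (F c , H c) ≤ (F a , H b);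
    -- on adding them the contribution of F a cancels.
    pivotTensor-weightedDiagonal : WeightedDiagonal pivotTensor v w
    pivotTensor-weightedDiagonal = record
      { support = support′ ; diagonal = λ x → *-nonZero (proj₁ (pivotA x)) (proj₁ (pivotB x)) }
      where
      rearrange : ∀ nFa Ga nFc Hc →
        (nFa ℕ.+ Ga) ℕ.+ (nFc ℕ.+ Hc) ≡ nFa ℕ.+ (Ga ℕ.+ (nFc ℕ.+ Hc))
      rearrange = solve-∀
      rearrange′ : ∀ nFb Gc nFa Hb →
        (nFb ℕ.+ Gc) ℕ.+ (nFa ℕ.+ Hb) ≡ nFa ℕ.+ (Gc ℕ.+ (nFb ℕ.+ Hb))
      rearrange′ = solve-∀
      support′ : ∀ a b c → pivotTensor a b c ≈ 0# ⊎
        (v a ℕ.+ w c ≤ v c ℕ.+ w b × (v a ℕ.+ w c ≡ v c ℕ.+ w b → a ≡ b × b ≡ c))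
      support′ a b c with pivot-≤ (pivotA a) (F b) (G c) | pivot-≤ (pivotB c) (F a) (H b)
      ... | inj₁ ≈0 | _       = inj₁ (trans (*-congʳ ≈0) (zeroˡ _))
      ... | inj₂ _  | inj₁ ≈0 = inj₁ (trans (*-congˡ ≈0) (zeroʳ _))
      ... | inj₂ ≤A | inj₂ ≤B = inj₂
        ( ℕ.+-cancelˡ-≤ (n ℕ.* toℕ (F a)) _ _ (≡.subst₂ _≤_ left right (ℕ.+-mono-≤ ≤A ≤B))
        , λ eq → equalities (tight-sum ≤A ≤B
                   (≡.trans left (≡.trans (cong (n ℕ.* toℕ (F a) ℕ.+_) eq) (≡.sym right)))) )
        where
        left : toℕ (combine (F a) (G a)) ℕ.+ w c ≡ n ℕ.* toℕ (F a) ℕ.+ (v a ℕ.+ w c)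
        left rewrite Fin.toℕ-combine (F a) (G a) | Fin.toℕ-combine (F c) (H c) =
          rearrange (n ℕ.* toℕ (F a)) (v a) (n ℕ.* toℕ (F c)) (toℕ (H c))
        right : toℕ (combine (F b) (G c)) ℕ.+ toℕ (combine (F a) (H b)) ≡ n ℕ.* toℕ (F a) ℕ.+ (v c ℕ.+ w b)
        right rewrite Fin.toℕ-combine (F b) (G c) | Fin.toℕ-combine (F a) (H b) | Fin.toℕ-combine (F b) (H b) =
          rearrange′ (n ℕ.* toℕ (F b)) (v c) (n ℕ.* toℕ (F a)) (toℕ (H b))
        -- Equality in both conditions gives a and c the same pivot in `TA`, and b and c the same
        -- pivot in `TB`.
        equalities :
          toℕ (combine (F a) (G a)) ≡ toℕ (combine (F b) (G c)) ×
          w c ≡ toℕ (combine (F a) (H b)) → a ≡ b × b ≡ c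
        equalities (eqA , eqB)
          with Fin.combine-injective (F a) (G a) (F b) (G c) (Fin.toℕ-injective eqA)
             | Fin.combine-injective (F c) (H c) (F a) (H b) (Fin.toℕ-injective eqB)
        ... | Fa≡Fb , Ga≡Gc | Fc≡Fa , Hc≡Hb = ≡.trans a≡c (≡.sym b≡c) , b≡c
          where
          a≡c = injectiveA (cong₂ _,_ (≡.sym Fc≡Fa) Ga≡Gc)
          b≡c = injectiveB (cong₂ _,_ (≡.sym (≡.trans Fc≡Fa Fa≡Fb)) (≡.sym Hc≡Hb))

    -- Two factors of `T` restrict to `TA` and `TB`, hence to one copy of the pivot tensor. For odd
    -- m the last factor is collapsed to the scalar 1 by rescaling a pivot entry of `TA`, taken from
    -- slice `o`.
    kronPow-pivotTensor-≼ : ∀ {T : Tensor 𝔽 n n n} → Fin n → TA ≼ T → TB ≼ T →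
      ∀ m → kronPow 𝔽 pivotTensor ⌊ m /2⌋ ≼ kronPow 𝔽 T m
    kronPow-pivotTensor-≼ {T} o TA≼T TB≼T zero = ≼-refl {T = kronPow 𝔽 T 0}
    kronPow-pivotTensor-≼ {T} o TA≼T TB≼T (suc zero) with inverse (TA o (F o) (G o)) (proj₁ (pivotA o))
    ... | s , TA*s≈1 = ≼-trans
      (rescaledSubtensor-≼ {T = TA ⊠ kronPow 𝔽 T 0} (λ _ → s) (combine o) (combine (F o)) (combine (G o)) λ x y z → begin
        s * (TA ⊠ kronPow 𝔽 T 0) (combine o x) (combine (F o) y) (combine (G o) z)
          ≈⟨ *-congˡ (reflexive (⊠-combine TA (kronPow 𝔽 T 0) o x (F o) y (G o) z)) ⟩
        s * (TA o (F o) (G o) * 1#) ≈⟨ *-congˡ (*-identityʳ _) ⟩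
        s * TA o (F o) (G o)        ≈⟨ *-comm _ _ ⟩
        TA o (F o) (G o) * s        ≈⟨ TA*s≈1 ⟩
        1#                          ∎)
      (⊠-mono-≼ TA≼T (≼-refl {T = kronPow 𝔽 T 0}))
    kronPow-pivotTensor-≼ {T} o TA≼T TB≼T (suc (suc m)) = ≼-trans
      (subtensor-≼ {T = TA ⊠ (TB ⊠ P)}
        -- The power is nested as `TA ⊠ (TB ⊠ P)`, so each index has three components: one for `TA`,
        -- one for `TB`, and the remaining word.
        (λ x → combine (quo x) (combine (F (quo x)) (rem x)))
        (λ y → combine (F (quo y)) (combine (H (quo y)) (rem y)))
        (λ z → combine (G (quo z)) (combine (quo z) (rem z)))
        λ x y z → trans
          (reflexive (≡.trans
            (⊠-combine TA (TB ⊠ P)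
              (quo x) (combine (F (quo x)) (rem x))
              (F (quo y)) (combine (H (quo y)) (rem y))
              (G (quo z)) (combine (quo z) (rem z)))
            (cong (TA (quo x) (F (quo y)) (G (quo z)) *_)
              (⊠-combine TB P (F (quo x)) (rem x) (H (quo y)) (rem y) (quo z) (rem z)))))
          (sym (*-assoc _ _ _)))
      (⊠-mono-≼ TA≼T
        (⊠-mono-≼ TB≼T (kronPow-pivotTensor-≼ o TA≼T TB≼T m)))
      where
      P = kronPow 𝔽 pivotTensor ⌊ m /2⌋
      quo : Fin (n ℕ.* n ℕ.^ ⌊ m /2⌋) → Fin n
      quo = quotient (n ℕ.^ ⌊ m /2⌋)
      rem : Fin (n ℕ.* n ℕ.^ ⌊ m /2⌋) → Fin (n ℕ.^ ⌊ m /2⌋)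
      rem = remainder {n} (n ℕ.^ ⌊ m /2⌋)

    -- `B` counts the values 0, ..., k n² available to either weight on words of length k, so the
    -- pigeonhole loss B² is polynomial in m.
    pivotTensor-power-subrank : ∀ {T : Tensor 𝔽 n n n} → Fin n → TA ≼ T → TB ≼ T → ∀ m →
      let k = ⌊ m /2⌋ ; B = suc (k ℕ.* (n ℕ.* n)) in
      ∃[ r ] (SubrankAtLeast 𝔽 (kronPow 𝔽 T m) r × n ℕ.^ k ≤ r ℕ.* (B ℕ.* B))
    pivotTensor-power-subrank {T} o TA≼T TB≼T m =
      let (r , unit≼ , n^k≤) = kronPow-subrank pivotTensor-weightedDiagonal ⌊ m /2⌋
            (λ x → s≤s (wordWeight-≤ v v≤ ⌊ m /2⌋ x)) (λ x → s≤s (wordWeight-≤ w w≤ ⌊ m /2⌋ x))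
          restrict L₁ L₂ L₃ ≈unit = ≼-trans unit≼ (kronPow-pivotTensor-≼ o TA≼T TB≼T m)
      in r , (L₁ , L₂ , L₃ , λ x y z → trans (apply≈trilinear L₁ L₂ L₃ _ x y z) (≈unit x y z)) , n^k≤
      where
      w≤ : ∀ x → w x ≤ n ℕ.* n
      w≤ x = ℕ.<⇒≤ (Fin.toℕ<n (combine (F x) (H x)))
      -- The crude bound n² lets `v` share the common `K` with `w`.
      v≤ : ∀ x → v x ≤ n ℕ.* n
      v≤ x = ℕ.≤-trans (ℕ.m≤n+m _ (n ℕ.* toℕ (F x)))
        (ℕ.≤-trans (ℕ.≤-reflexive (≡.sym (Fin.toℕ-combine (F x) (G x)))) (ℕ.<⇒≤ (Fin.toℕ<n (combine (F x) (G x)))))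

theorem5p19 : ∀ {c ℓ : Level} (𝔽 : Field c ℓ) (n : ℕ) (T : Tensor 𝔽 n n n) →
    Concise 𝔽 T → PivotMatched 𝔽 T → AsymptoticSubrankAtLeastSqrt 𝔽 T n
-- The case n = 0 is vacuous, since a² < 0 is impossible; for `suc n` the index `zero` supplies the
-- slice `o`.
theorem5p19 𝔽 (suc n) T _
  (TA , TB , pA , pB , TA≅T , TB≅T , pivotA , pivotB , injectiveA , injectiveB , f≡f) a b 0<b a²<nb² =
  let (M , bound) = growth-from-square a b (suc n) (suc n ℕ.* suc n) 0<b a²<nb²
  in M , λ m M≤m →
    let (r , subrank , n^k≤) = pivotTensor-power-subrank TA TB (proj₁ ∘ pA) (proj₂ ∘ pA) (proj₂ ∘ pB)
          pivotA pivotB′ injectiveA injectiveB′ zero (Isomorphic⇒≼ TA T TA≅T) (Isomorphic⇒≼ TB T TB≅T) m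
    in r , subrank , bound m r M≤m n^k≤
  where
  open Restriction 𝔽
  open Subrank 𝔽
  -- The matching condition rewrites the pivots of `TB` with the first component of `pA`, so that
  -- one map `F` serves both tensors.
  pivotB′ : ∀ ℓ → IsPivot 𝔽 (slice₃ 𝔽 TB ℓ) (proj₁ (pA ℓ) , proj₂ (pB ℓ))
  pivotB′ ℓ = subst (λ f → IsPivot 𝔽 (slice₃ 𝔽 TB ℓ) (f , proj₂ (pB ℓ))) (≡.sym (f≡f ℓ)) (pivotB ℓ)
  injectiveB′ : Injective _≡_ _≡_ (λ ℓ → proj₁ (pA ℓ) , proj₂ (pB ℓ))
  injectiveB′ {x} {y} eq = injectiveB (cong₂ _,_
    (≡.trans (≡.sym (f≡f x)) (≡.trans (cong proj₁ eq) (f≡f y))) (cong proj₂ eq))
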